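{- Let $G$ and $H$ be simple connected graphs. Then the Cartesian product $G \Box H$ and the Kronecker product $G \otimes H$ are isomorphic if and only if $G$ and $H$ are odd cycles of the same length.
   Context: All graphs are finite, undirected and simple (no loops or multiple edges). An odd cycle is a cycle graph $C_n$ on $n$ vertices with $n \ge 3$ odd; its length is $n$. For graphs $G$ and $H$, the following products have vertex set $V(G)\times V(H)$. The Cartesian product $G \Box H$: $(x,y)\sim(x',y')$ if either ($x\sim x'$ in $G$ and $y=y'$) or ($x=x'$ and $y\sim y'$ in $H$). The Kronecker (direct) product $G\otimes H$: $(x,y)\sim(x',y')$ if $x\sim x'$ in $G$ and $y\sim y'$ in $H$. Two graphs are isomorphic if there is a bijection between their vertex sets such that two vertices are adjacent in the first graph if and only if their images are adjacent in the second.
   Formalization: The case where G and H are both the one-vertex graph is excluded: there both products are a single vertex, hence isomorphic, although a single vertex is not an odd cycle; connected graphs are taken to be nonempty. -}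

module Defs where

open import Data.Empty using (⊥)
open import Data.Fin using (Fin; toℕ)
open import Data.Fin.Properties using (*↔×) renaming (_≟_ to _≟F_)
open import Data.Nat using (ℕ; suc; _*_; _≤_; s≤s) renaming (_≟_ to _≟ℕ_)
open import Data.Nat.Divisibility using (_∣_)
open import Data.Nat.Properties using (1+n≢n)
open import Data.Product using (Σ; _×_; _,_)
open import Data.Product.Function.NonDependent.Propositional using (_×-↔_)
open import Data.Sum using (_⊎_; inj₁; inj₂; swap)
open import Function.Bundles using (_↔_; _⇔_; Inverse)
open import Function.Construct.Composition using (_↔-∘_)
open import Function.Construct.Identity using (↔-id)
open import Function.Construct.Symmetry using (↔-sym)
open import Function.Properties.Inverse using (↔⇒↣)
open import Relation.Binary.Core using (Rel)
open import Relation.Binary.Construct.Closure.ReflexiveTransitive using (Star)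
open import Relation.Binary.Definitions using (Decidable; DecidableEquality; Symmetric)
open import Relation.Binary.PropositionalEquality using (_≡_; refl; sym; trans; cong)
open import Relation.Nullary using (¬_)
open import Relation.Nullary.Decidable using (via-injection; _×-dec_; _⊎-dec_)

-- Finite simple graphs.  Adjacency is a decidable relation, as it always is
-- classically; its proofs carry no multiplicity, since only inhabitation of
-- Adj x y is ever used.
record Graph : Set₁ where
  field
    V      : Set
    order  : ℕ
    enum   : V ↔ Fin order
    Adj    : Rel V _
    adj?   : Decidable Adj
    symm   : Symmetric Adj
    irrefl : ∀ x → ¬ Adj x x

  _≟V_ : DecidableEquality V
  _≟V_ = via-injection (↔⇒↣ enum) _≟F_

open Graph public using (V; order; Adj)

-- Connected graphs are nonempty by convention.
Connected : Graph → Set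
Connected G = V G × (∀ x y → Star (Adj G) x y)

infix 4 _≅_

_≅_ : Graph → Graph → Set
G ≅ H = Σ (V G ↔ V H) λ f →
        ∀ x y → Adj G x y ⇔ Adj H (Inverse.to f x) (Inverse.to f y)

private
  enum-× : (G H : Graph) → (V G × V H) ↔ Fin (order G * order H)
  enum-× G H = ↔-sym *↔× ↔-∘ (Graph.enum G ×-↔ Graph.enum H)

infixr 7 _□_ _⊗_

_□_ : Graph → Graph → Graph
G □ H = record
  { V      = V G × V H
  ; order  = order G * order H
  ; enum   = enum-× G H
  ; Adj    = λ { (x , y) (x′ , y′) →
                 (Adj G x x′ × y ≡ y′) ⊎ (x ≡ x′ × Adj H y y′) }
  ; adj?   = λ { (x , y) (x′ , y′) →
                 (Graph.adj? G x x′ ×-dec Graph._≟V_ H y y′)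
                 ⊎-dec (Graph._≟V_ G x x′ ×-dec Graph.adj? H y y′) }
  ; symm   = λ { (inj₁ (a , e)) → inj₁ (Graph.symm G a , sym e)
               ; (inj₂ (e , a)) → inj₂ (sym e , Graph.symm H a) }
  ; irrefl = λ { (x , y) (inj₁ (a , _)) → Graph.irrefl G x a
               ; (x , y) (inj₂ (_ , a)) → Graph.irrefl H y a }
  }

_⊗_ : Graph → Graph → Graph
G ⊗ H = record
  { V      = V G × V H
  ; order  = order G * order H
  ; enum   = enum-× G H
  ; Adj    = λ { (x , y) (x′ , y′) → Adj G x x′ × Adj H y y′ }
  ; adj?   = λ { (x , y) (x′ , y′) → Graph.adj? G x x′ ×-dec Graph.adj? H y y′ }
  ; symm   = λ { (a , b) → Graph.symm G a , Graph.symm H b }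
  ; irrefl = λ { (x , _) (a , _) → Graph.irrefl G x a }
  }

-- j is the cyclic successor of i, i.e. j ≡ i + 1 (mod n).
Next : (n : ℕ) → Fin n → Fin n → Set
Next n i j = (toℕ j ≡ suc (toℕ i)) ⊎ (suc (toℕ i) ≡ n × toℕ j ≡ 0)

private
  Next-irrefl : ∀ n → 3 ≤ n → (i : Fin n) → ¬ Next n i i
  Next-irrefl n _ i (inj₁ e) = 1+n≢n (sym e)
  Next-irrefl n 3≤n i (inj₂ (e , z)) = absurd 3≤n (trans (sym e) (cong suc z))
    where
    absurd : ∀ {m} → 3 ≤ m → m ≡ 1 → ⊥
    absurd (s≤s ()) refl

  next? : ∀ n → Decidable (Next n)
  next? n i j = (toℕ j ≟ℕ suc (toℕ i))
                ⊎-dec ((suc (toℕ i) ≟ℕ n) ×-dec (toℕ j ≟ℕ 0))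

cycle : (n : ℕ) → 3 ≤ n → Graph
cycle n 3≤n = record
  { V      = Fin n
  ; order  = n
  ; enum   = ↔-id (Fin n)
  ; Adj    = λ i j → Next n i j ⊎ Next n j i
  ; adj?   = λ i j → next? n i j ⊎-dec next? n j i
  ; symm   = swap
  ; irrefl = λ { i (inj₁ p) → Next-irrefl n 3≤n i p
               ; i (inj₂ p) → Next-irrefl n 3≤n i p }
  }

IsOddCycleOfLength : ℕ → Graph → Set
IsOddCycleOfLength n G = ¬ (2 ∣ n) × Σ (3 ≤ n) λ 3≤n → G ≅ cycle n 3≤n

-- With G and H both the one-vertex graph K₁, G □ H and G ⊗ H are both K₁
-- although K₁ is not an odd cycle (cycles have length at least 3).  This is
-- the only such pair of connected graphs, so it has to be excluded.
NotBothTrivial : Graph → Graph → Set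
NotBothTrivial G H = ¬ (order G ≡ 1 × order H ≡ 1)

{-# OPTIONS --safe #-}

-- An isomorphism G □ H ≅ G ⊗ H matches degrees d(x) + d(y) with degrees d(u) d(v).
-- Comparing the maxima gives Δ + Δ′ = Δ Δ′, hence Δ = Δ′ = 2 (Δ = Δ′ = 0 being the case of
-- single vertices), and a vertex of degree 1 would produce the degree 3 in G □ H, which is
-- not a product of factors 1 and 2. So G and H are connected and 2-regular, that is,
-- cycles of lengths m and n. In an n-cycle the displacement of a closed walk of odd length
-- k is odd, of absolute value at most k, and a multiple of n; so n is odd and n ≤ k. Since
-- G ⊗ H is connected one of the cycles is odd, and going once around it in G □ H,
-- transporting the walk to G ⊗ H and projecting to the other factor shows that the other
-- is odd and not longer; by symmetry m = n.
--
-- Conversely, for odd n the map (x , y) ↦ (x + y , x − y) on ℤ/n is invertible and takes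
-- the unit steps (±1 , 0), (0 , ±1) to the diagonal steps (±1 , ±1).
module Submission where

open import Defs
open import Data.Fin using (Fin; zero; suc; toℕ; fromℕ<)
open import Data.Fin.Properties using (toℕ-fromℕ<; toℕ<n; toℕ-injective; pigeonhole)
open import Data.Integer as ℤ using (ℤ; +_; 0ℤ; 1ℤ) renaming (∣_∣ to abs)
open import Data.Integer.DivMod using (n%ℕd<d; a≡a%ℕn+[a/ℕn]*n; _%ℕ_; _/ℕ_)
open import Data.Integer.Divisibility.Signed as ℤ∣ using (divides)
import Data.Integer.Properties as ℤ
open import Data.Integer.Tactic.RingSolver using (solve-∀)
open import Data.List using (List; []; _∷_; _++_; length; map; filter; tabulate; cartesianProduct)
open import Data.List.Extrema.Nat using (argmax; f[xs]≤f[argmax])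
open import Data.List.Membership.Propositional using (_∈_)
open import Data.List.Membership.Propositional.Properties
  using (∈-tabulate⁺; ∈-filter⁺; ∈-filter⁻; ∈-map⁺; ∈-map⁻; ∈-++⁺ˡ; ∈-++⁺ʳ; ∈-++⁻;
         ∈-cartesianProduct⁺; ∈-cartesianProduct⁻)
open import Data.List.Membership.Propositional.Properties.WithK using (unique∧set⇒bag)
open import Data.List.Properties using (length-++; length-map)
open import Data.List.Relation.Binary.BagAndSetEquality using (∼bag⇒↭)
open import Data.List.Relation.Binary.Permutation.Propositional.Properties using (↭-length)
open import Data.List.Relation.Unary.All using ([]; _∷_; lookup)
open import Data.List.Relation.Unary.AllPairs using ([]; _∷_)
open import Data.List.Relation.Unary.Any using (here; there)
open import Data.List.Relation.Unary.Unique.Propositional using (Unique)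
open import Data.List.Relation.Unary.Unique.Propositional.Properties
  using (tabulate⁺; filter⁺; map⁺; ++⁺; cartesianProduct⁺)
open import Data.Nat using (ℕ; zero; suc; _+_; _*_; _≤_; _<_; z≤n; s≤s; z<s; s≤s⁻¹; NonZero; ≢-nonZero)
open import Data.Nat.Divisibility
  using (_∣_; divides; _∣?_; ∣⇒≤; >⇒∤; ∣m+n∣m⇒∣n; ∣m∣n⇒∣m+n; ∣1⇒≡1; ∣-refl)
open import Data.Nat.Induction using (<-rec)
open import Data.Nat.Properties
open import Data.Product using (Σ; ∃; ∃₂; _×_; _,_; proj₁; proj₂)
open import Data.Product.Function.NonDependent.Propositional using (_×-↔_; _×-⇔_)
open import Data.Product.Properties using (,-injectiveˡ; ,-injectiveʳ)
open import Data.Sum using (_⊎_; inj₁; inj₂; [_,_])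
open import Data.Sum.Function.Propositional using (_⊎-⇔_)
open import Function using (_∘_; id; case_of_; mk⇔; mk↔ₛ′)
open import Function.Bundles using (_⇔_; _↔_; Equivalence; Injection; Inverse)
open import Function.Construct.Composition using (_⇔-∘_; _↔-∘_)
open import Function.Construct.Symmetry using (↔-sym; ⇔-sym)
open import Function.Properties.Inverse using (↔⇒↣)
open import Relation.Binary.Construct.Closure.ReflexiveTransitive using (Star; ε; _◅_; _◅◅_; gmap)
open import Relation.Binary.Definitions using (tri<; tri≈; tri>)
open import Relation.Binary.PropositionalEquality
  using (_≡_; _≢_; refl; sym; trans; cong; cong₂; subst; subst₂)
open import Relation.Nullary using (¬_; contradiction; yes; no)
open import Relation.Unary using (Decidable)

open Graph using (enum; adj?; symm; irrefl; _≟V_)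
open Inverse using (to; from; strictlyInverseˡ; strictlyInverseʳ)

-- Isomorphisms

to-injective : ∀ {a b} {A : Set a} {B : Set b} (f : A ↔ B) {x y} → to f x ≡ to f y → x ≡ y
to-injective f = Injection.injective (↔⇒↣ f)

≅-sym : ∀ G H → G ≅ H → H ≅ G
≅-sym G H (f , f-adj) = ↔-sym f , λ x y → ⇔-sym (f-adj _ _) ⇔-∘ mk⇔
  (subst₂ (Adj H) (sym (strictlyInverseˡ f x)) (sym (strictlyInverseˡ f y)))
  (subst₂ (Adj H) (strictlyInverseˡ f x) (strictlyInverseˡ f y))

≅-trans : ∀ G H K → G ≅ H → H ≅ K → G ≅ K
≅-trans G H K (f , f-adj) (g , g-adj) = g ↔-∘ f , λ x y → g-adj _ _ ⇔-∘ f-adj x y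

≡-⇔ : ∀ {a b} {A : Set a} {B : Set b} (f : A ↔ B) {x y} → x ≡ y ⇔ to f x ≡ to f y
≡-⇔ f = mk⇔ (cong (to f)) (to-injective f)

□-cong : ∀ G G′ H H′ → G ≅ G′ → H ≅ H′ → (G □ H) ≅ (G′ □ H′)
□-cong G G′ H H′ (f , f-adj) (g , g-adj) = (f ×-↔ g) ,
  λ (x , y) (x′ , y′) → (f-adj x x′ ×-⇔ ≡-⇔ g) ⊎-⇔ (≡-⇔ f ×-⇔ g-adj y y′)

⊗-cong : ∀ G G′ H H′ → G ≅ G′ → H ≅ H′ → (G ⊗ H) ≅ (G′ ⊗ H′)
⊗-cong G G′ H H′ (f , f-adj) (g , g-adj) = (f ×-↔ g) ,
  λ (x , y) (x′ , y′) → f-adj x x′ ×-⇔ g-adj y y′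

-- Degrees

vertices : (G : Graph) → List (V G)
vertices G = tabulate (from (enum G))

∈-vertices : ∀ G x → x ∈ vertices G
∈-vertices G x =
  subst (_∈ vertices G) (strictlyInverseʳ (enum G) x) (∈-tabulate⁺ (to (enum G) x))

neighbours : (G : Graph) → V G → List (V G)
neighbours G x = filter (adj? G x) (vertices G)

neighbours-unique : ∀ G x → Unique (neighbours G x)
neighbours-unique G x =
  filter⁺ (adj? G x) (tabulate⁺ (to-injective (↔-sym (enum G))))

∈-neighbours : ∀ G x {y} → y ∈ neighbours G x ⇔ Adj G x y
∈-neighbours G x = mk⇔
  (λ y∈ → proj₂ (∈-filter⁻ (adj? G x) {xs = vertices G} y∈))
  (∈-filter⁺ (adj? G x) (∈-vertices G _))

degree : (G : Graph) → V G → ℕ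
degree G x = length (neighbours G x)

-- Duplicate-free lists with the same members are permutations of each other, so any repetition-free
-- listing of the neighbours has the right length. The degree formulas below each supply such a
-- listing.
degree-unique : ∀ G x {ys} → Unique ys → (∀ {y} → y ∈ ys ⇔ Adj G x y) → degree G x ≡ length ys
degree-unique G x ys! ys⇔ = ↭-length (∼bag⇒↭
  (unique∧set⇒bag (neighbours-unique G x) ys! (⇔-sym ys⇔ ⇔-∘ ∈-neighbours G x)))

degree-≅ : ∀ G H (φ : G ≅ H) x → degree H (to (proj₁ φ) x) ≡ degree G x
degree-≅ G H (f , f-adj) x = trans
  (degree-unique H (to f x) (map⁺ (to-injective f) (neighbours-unique G x)) (mk⇔ image preimage))
  (length-map (to f) (neighbours G x))
  where
  image : ∀ {y} → y ∈ map (to f) (neighbours G x) → Adj H (to f x) y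
  image y∈ with ∈-map⁻ (to f) y∈
  ... | z , z∈ , refl = Equivalence.to (f-adj x z) (Equivalence.to (∈-neighbours G x) z∈)

  preimage : ∀ {y} → Adj H (to f x) y → y ∈ map (to f) (neighbours G x)
  preimage {y} a = subst (_∈ _) (strictlyInverseˡ f y)
    (∈-map⁺ (to f) (Equivalence.from (∈-neighbours G x) (Equivalence.from (f-adj x (from f y))
      (subst (Adj H (to f x)) (sym (strictlyInverseˡ f y)) a))))

degree-□ : ∀ G H x y → degree (G □ H) (x , y) ≡ degree G x + degree H y
degree-□ G H x y = trans
  (degree-unique (G □ H) (x , y) (++⁺ (map⁺ ,-injectiveˡ (neighbours-unique G x))
                                 (map⁺ ,-injectiveʳ (neighbours-unique H y)) disjoint)
                 (mk⇔ ⇒ ⇐))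
  (trans (length-++ ns)
    (cong₂ _+_ (length-map (_, y) (neighbours G x)) (length-map (x ,_) (neighbours H y))))
  where
  ns = map (_, y) (neighbours G x)
  ms = map (x ,_) (neighbours H y)

  -- A common member would be `(x , y)` itself, with `x` adjacent to `x`.
  disjoint : ∀ {z} → ¬ (z ∈ ns × z ∈ ms)
  disjoint (z∈ns , z∈ms) with ∈-map⁻ (_, y) z∈ns | ∈-map⁻ (x ,_) z∈ms
  ... | _ , x∈ , refl | _ , _ , refl = irrefl G x (Equivalence.to (∈-neighbours G x) x∈)

  ⇒ : ∀ {z} → z ∈ ns ++ ms → Adj (G □ H) (x , y) z
  ⇒ z∈ with ∈-++⁻ ns z∈
  ... | inj₁ z∈ns with ∈-map⁻ (_, y) z∈ns
  ...   | _ , x′∈ , refl = inj₁ (Equivalence.to (∈-neighbours G x) x′∈ , refl)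
  ⇒ z∈ | inj₂ z∈ms with ∈-map⁻ (x ,_) z∈ms
  ...   | _ , y′∈ , refl = inj₂ (refl , Equivalence.to (∈-neighbours H y) y′∈)

  ⇐ : ∀ {z} → Adj (G □ H) (x , y) z → z ∈ ns ++ ms
  ⇐ (inj₁ (a , refl)) = ∈-++⁺ˡ (∈-map⁺ (_, y) (Equivalence.from (∈-neighbours G x) a))
  ⇐ (inj₂ (refl , a)) = ∈-++⁺ʳ ns (∈-map⁺ (x ,_) (Equivalence.from (∈-neighbours H y) a))

length-cartesianProduct : ∀ {a b} {A : Set a} {B : Set b} (xs : List A) (ys : List B) →
  length (cartesianProduct xs ys) ≡ length xs * length ys
length-cartesianProduct []       ys = refl
length-cartesianProduct (x ∷ xs) ys = trans (length-++ (map (x ,_) ys))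
  (cong₂ _+_ (length-map (x ,_) ys) (length-cartesianProduct xs ys))

degree-⊗ : ∀ G H x y → degree (G ⊗ H) (x , y) ≡ degree G x * degree H y
degree-⊗ G H x y = trans
  (degree-unique (G ⊗ H) (x , y) (cartesianProduct⁺ (neighbours-unique G x) (neighbours-unique H y))
    (mk⇔ (λ z∈ → let x∈ , y∈ = ∈-cartesianProduct⁻ (neighbours G x) (neighbours H y) z∈ in
                 Equivalence.to (∈-neighbours G x) x∈ , Equivalence.to (∈-neighbours H y) y∈)
         (λ (a , b) → ∈-cartesianProduct⁺ (Equivalence.from (∈-neighbours G x) a)
                                          (Equivalence.from (∈-neighbours H y) b))))
  (length-cartesianProduct (neighbours G x) (neighbours H y))

adj⇒0<degree : ∀ G {x y} → Adj G x y → 0 < degree G x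
adj⇒0<degree G {x} {y} a with neighbours G x | Equivalence.from (∈-neighbours G x) a
... | _ ∷ _ | _ = s≤s z≤n

-- A path to another vertex would start with an edge at `x`.
degree≡0⇒singleton : ∀ G → Connected G → ∀ x → degree G x ≡ 0 → ∀ y → x ≡ y
degree≡0⇒singleton G (_ , path) x d≡0 y with path x y
... | ε     = refl
... | a ◅ _ = contradiction d≡0 (>⇒≢ (adj⇒0<degree G a))

singleton⇒order≡1 : ∀ G {x} → (∀ y → x ≡ y) → order G ≡ 1
singleton⇒order≡1 G {x} x≡ = fin-singleton (to (enum G) x)
  (λ i → trans (cong (to (enum G)) (x≡ (from (enum G) i))) (strictlyInverseˡ (enum G) i))
  where
  fin-singleton : ∀ {n} (i : Fin n) → (∀ j → i ≡ j) → n ≡ 1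
  fin-singleton {suc zero}    i i≡ = refl
  fin-singleton {suc (suc n)} i i≡ with () ← trans (sym (i≡ zero)) (i≡ (suc zero))

-- Maximum degrees and 2-regularity

maxDegree : ∀ G → V G → ∃ λ x → ∀ y → degree G y ≤ degree G x
maxDegree G x₀ = argmax (degree G) x₀ (vertices G) ,
  λ y → lookup (f[xs]≤f[argmax] x₀ (vertices G)) (∈-vertices G y)

-- The equation is (m - 1)(n - 1) = 1 in disguise; in the last clause, where the arguments are
-- `suc (suc m)` and `suc n`, it becomes `suc m * n ≡ 1`.
m+n≡m*n⇒both-0-or-2 : ∀ m n → m + n ≡ m * n → (m ≡ 0 × n ≡ 0) ⊎ (m ≡ 2 × n ≡ 2)
m+n≡m*n⇒both-0-or-2 zero          n       eq = inj₁ (refl , eq)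
m+n≡m*n⇒both-0-or-2 (suc zero)    n       eq = contradiction (trans eq (+-identityʳ n)) 1+n≢n
m+n≡m*n⇒both-0-or-2 (suc (suc m)) zero    eq with () ← trans eq (*-zeroʳ m)
m+n≡m*n⇒both-0-or-2 (suc (suc m)) (suc n) eq =
  inj₂ ( cong suc (m*n≡1⇒m≡1 (suc m) n [1+m]*n≡1)
       , cong suc (m*n≡1⇒n≡1 (suc m) n [1+m]*n≡1))
  where
  2+m≡[1+m]*[1+n] : suc (suc m) ≡ suc m * suc n
  2+m≡[1+m]*[1+n] = +-cancelˡ-≡ (suc n) _ _ (trans (+-comm (suc n) (suc (suc m))) eq)

  [1+m]*n≡1 : suc m * n ≡ 1
  [1+m]*n≡1 = sym (+-cancelˡ-≡ (suc m) 1 (suc m * n)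
    (trans (+-comm (suc m) 1) (trans 2+m≡[1+m]*[1+n] (*-suc (suc m) n))))

degree-1-or-2 : ∀ G → Connected G → ∀ {x₀} → degree G x₀ ≡ 2 → (∀ x → degree G x ≤ degree G x₀) →
  ∀ x → degree G x ≡ 1 ⊎ degree G x ≡ 2
degree-1-or-2 G conn {x₀} d≡2 G≤ x with degree G x in e | ≤-trans (G≤ x) (≤-reflexive d≡2)
... | suc zero          | _ = inj₁ refl
... | suc (suc zero)    | _ = inj₂ refl
... | suc (suc (suc _)) | s≤s (s≤s ())
-- Degree 0 would make `x` the only vertex, hence equal to `x₀`, whose degree is 2.
... | zero              | _
  with refl ← degree≡0⇒singleton G conn x e x₀ with () ← trans (sym e) d≡2

module _ (G H : Graph) (φ : (G □ H) ≅ (G ⊗ H)) where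

  degree-sum≡product : ∀ x y → ∃₂ λ u v → degree G x + degree H y ≡ degree G u * degree H v
  degree-sum≡product x y = u , v ,
    trans (sym (degree-□ G H x y)) (trans (sym (degree-≅ (G □ H) (G ⊗ H) φ (x , y))) (degree-⊗ G H u v))
    where
    u = proj₁ (to (proj₁ φ) (x , y))
    v = proj₂ (to (proj₁ φ) (x , y))

  degree-product≡sum : ∀ u v → ∃₂ λ x y → degree G u * degree H v ≡ degree G x + degree H y
  degree-product≡sum u v = x , y ,
    trans (sym (degree-⊗ G H u v))
      (trans (cong (degree (G ⊗ H)) (sym (strictlyInverseˡ (proj₁ φ) (u , v))))
        (trans (degree-≅ (G □ H) (G ⊗ H) φ (x , y)) (degree-□ G H x y)))
    where
    x = proj₁ (from (proj₁ φ) (u , v))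
    y = proj₂ (from (proj₁ φ) (u , v))

  module _ (G-conn : Connected G) (H-conn : Connected H) (¬triv : NotBothTrivial G H)
           {x₀ y₀} (G≤ : ∀ x → degree G x ≤ degree G x₀) (H≤ : ∀ y → degree H y ≤ degree H y₀) where

    maxDegrees≡2 : degree G x₀ ≡ 2 × degree H y₀ ≡ 2
    -- The largest degree sum is some degree product, and the largest degree product is some degree
    -- sum; each is therefore bounded by the other.
    maxDegrees≡2 with m+n≡m*n⇒both-0-or-2 (degree G x₀) (degree H y₀) (≤-antisym
        (let u , v , e = degree-sum≡product x₀ y₀ in
           ≤-trans (≤-reflexive e) (*-mono-≤ (G≤ u) (H≤ v)))
        (let x , y , e = degree-product≡sum x₀ y₀ in
           ≤-trans (≤-reflexive e) (+-mono-≤ (G≤ x) (H≤ y))))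
    ... | inj₂ e = e
    ... | inj₁ (d , e) = contradiction
      ( singleton⇒order≡1 G (degree≡0⇒singleton G G-conn x₀ d)
      , singleton⇒order≡1 H (degree≡0⇒singleton H H-conn y₀ e)) ¬triv

    private
      G-degrees = degree-1-or-2 G G-conn (proj₁ maxDegrees≡2) G≤
      H-degrees = degree-1-or-2 H H-conn (proj₂ maxDegrees≡2) H≤

    degree-product≢3 : ∀ u v → degree G u * degree H v ≢ 3
    degree-product≢3 u v e with degree G u | G-degrees u | degree H v | H-degrees v
    degree-product≢3 u v () | _ | inj₁ refl | _ | inj₁ refl
    degree-product≢3 u v () | _ | inj₁ refl | _ | inj₂ refl
    degree-product≢3 u v () | _ | inj₂ refl | _ | inj₁ refl
    degree-product≢3 u v () | _ | inj₂ refl | _ | inj₂ refl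

    degree-sum≢3 : ∀ x y → degree G x + degree H y ≢ 3
    degree-sum≢3 x y e = let u , v , e′ = degree-sum≡product x y in
      degree-product≢3 u v (trans (sym e′) e)

    G-regular : ∀ x → degree G x ≡ 2
    G-regular x with G-degrees x
    ... | inj₂ e = e
    ... | inj₁ e = contradiction (cong₂ _+_ e (proj₂ maxDegrees≡2)) (degree-sum≢3 x y₀)

    H-regular : ∀ y → degree H y ≡ 2
    H-regular y with H-degrees y
    ... | inj₂ e = e
    ... | inj₁ e = contradiction (cong₂ _+_ (proj₁ maxDegrees≡2) e) (degree-sum≢3 x₀ y)

2-regular : ∀ G H → (G □ H) ≅ (G ⊗ H) → Connected G → Connected H → NotBothTrivial G H →
  (∀ x → degree G x ≡ 2) × (∀ y → degree H y ≡ 2)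
2-regular G H φ G-conn H-conn ¬triv =
  let _ , G≤ = maxDegree G (proj₁ G-conn)
      _ , H≤ = maxDegree H (proj₁ H-conn)
  in G-regular G H φ G-conn H-conn ¬triv G≤ H≤ , H-regular G H φ G-conn H-conn ¬triv G≤ H≤

-- Connected 2-regular graphs

two-elements : ∀ {a} {A : Set a} {xs : List A} → length xs ≡ 2 → Unique xs → ∀ {x} → x ∈ xs →
  ∃ λ y → y ≢ x × y ∈ xs × (∀ {z} → z ∈ xs → z ≡ x ⊎ z ≡ y)
two-elements {xs = x ∷ y ∷ []} _ ((x≢y ∷ []) ∷ _) (here refl) =
  y , x≢y ∘ sym , there (here refl) , λ { (here z≡x) → inj₁ z≡x ; (there (here z≡y)) → inj₂ z≡y }
two-elements {xs = x ∷ y ∷ []} _ ((x≢y ∷ []) ∷ _) (there (here refl)) =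
  x , x≢y , here refl , λ { (here z≡x) → inj₂ z≡x ; (there (here z≡y)) → inj₁ z≡y }

Least : ∀ {p} → (ℕ → Set p) → Set p
Least P = ∃ λ n → P n × (∀ {k} → k < n → ¬ P k)

least : ∀ {p} {P : ℕ → Set p} → Decidable P → ∀ n → P n → Least P
least {P = P} P? = <-rec (λ n → P n → Least P) λ n smaller pn → case anyUpTo? P? n of λ where
  (yes (k , k<n , pk)) → smaller k<n pk
  (no ¬smaller)        → n , pn , λ k<n pk → ¬smaller (_ , k<n , pk)

IsCycle : Graph → Set
IsCycle G = ∃ λ n → Σ (3 ≤ n) λ 3≤n → G ≅ cycle n 3≤n

module RegularWalk (G : Graph) (regular : ∀ x → degree G x ≡ 2) where

  other : ∀ {v u} → Adj G v u → ∃ λ w → w ≢ u × Adj G v w × (∀ {z} → Adj G v z → z ≡ u ⊎ z ≡ w)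
  other {v} a =
    let u∈ = Equivalence.from (∈-neighbours G v) a
        w , w≢u , w∈ , only = two-elements (regular v) (neighbours-unique G v) u∈
    in w , w≢u , Equivalence.to (∈-neighbours G v) w∈ , only ∘ Equivalence.from (∈-neighbours G v)

  module _ (x₀ x₁ : V G) (x₀~x₁ : Adj G x₀ x₁) where

    -- The recursion carries an edge rather than a vertex: the walk continues to the neighbour other
    -- than the one it came from, so each vertex depends on the previous two.
    dart : ℕ → ∃₂ (Adj G)
    dart zero = x₀ , x₁ , x₀~x₁
    dart (suc k) = let u , v , u~v = dart k
                       w , _ , v~w , _ = other (symm G u~v) in v , w , v~w

    walk : ℕ → V G
    walk k = proj₁ (dart k)

    walk-adj : ∀ k → Adj G (walk k) (walk (suc k))
    walk-adj k = proj₂ (proj₂ (dart k))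

    walk-turn : ∀ k → walk (suc (suc k)) ≢ walk k
    walk-turn k = proj₁ (proj₂ (other (symm G (walk-adj k))))

    walk-neighbours : ∀ k {z} → Adj G (walk (suc k)) z → z ≡ walk k ⊎ z ≡ walk (suc (suc k))
    walk-neighbours k = proj₂ (proj₂ (proj₂ (other (symm G (walk-adj k)))))

    walk-step≢ : ∀ k → walk (suc k) ≢ walk k
    walk-step≢ k e = irrefl G (walk k) (subst (Adj G (walk k)) e (walk-adj k))

    Repeat : ℕ → Set
    Repeat n = ∃ λ i → i < n × walk n ≡ walk i

    firstRepeat : Least Repeat
    -- Among the first `suc (order G)` positions two share a vertex.
    firstRepeat with pigeonhole ≤-refl (to (enum G) ∘ walk ∘ toℕ {suc (order G)})
    ... | i , j , i<j , e = least (λ n → anyUpTo? (λ i → _≟V_ G (walk n) (walk i)) n) (toℕ j)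
      (toℕ i , i<j , sym (to-injective (enum G) e))

    walk-injective : ∀ {n} → (∀ {k} → k < n → ¬ Repeat k) →
      ∀ {i j} → i < n → j < n → walk i ≡ walk j → i ≡ j
    walk-injective simple {i} {j} i<n j<n e with <-cmp i j
    ... | tri< i<j _ _ = contradiction (i , i<j , sym e) (simple j<n)
    ... | tri≈ _ i≡j _ = i≡j
    ... | tri> _ _ j<i = contradiction (j , j<i , e) (simple i<n)

    -- The predecessor of the first repeated vertex is a neighbour of its earlier
    -- occurrence; unless that is the start, both neighbours there are already visited.
    repeat⇒closed : ∀ {n} → (∀ {k} → k < n → ¬ Repeat k) →
      ∀ i → i < n → walk n ≡ walk i → walk n ≡ walk 0
    repeat⇒closed         simple zero    _             e = e
    repeat⇒closed {suc n} simple (suc i) (s≤s i<n) e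
      with walk-neighbours i (symm G (subst (Adj G (walk n)) e (walk-adj n)))
    ... | inj₁ n≡i = contradiction (i , i<n , n≡i) (simple ≤-refl)
    ... | inj₂ n≡2+i with <-cmp (suc (suc i)) n
    ...   | tri< 2+i<n _ _ = contradiction (suc (suc i) , 2+i<n , n≡2+i) (simple ≤-refl)
    ...   | tri≈ _ refl _ = contradiction e (walk-turn (suc i))
    ...   | tri> _ _ n<2+i with refl ← ≤-antisym i<n (s≤s⁻¹ n<2+i) = contradiction e (walk-step≢ (suc i))

    closed⇒3≤ : ∀ {n} → 0 < n → walk n ≡ walk 0 → 3 ≤ n
    closed⇒3≤ {suc zero}          _ e = contradiction e (walk-step≢ 0)
    closed⇒3≤ {suc (suc zero)}    _ e = contradiction e (walk-turn 0)
    closed⇒3≤ {suc (suc (suc n))} _ _ = s≤s (s≤s (s≤s z≤n))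

    module _ {m} (simple : ∀ {k} → k < suc m → ¬ Repeat k) (3≤n : 3 ≤ suc m)
             (closed : walk (suc m) ≡ walk 0) where

      private
        n = suc m
        C = cycle n 3≤n

        at : Fin n → V G
        at i = walk (toℕ i)

        at-fromℕ< : ∀ {k} (k<n : k < n) → walk k ≡ at (fromℕ< k<n)
        at-fromℕ< k<n = cong walk (sym (toℕ-fromℕ< k<n))

        at-injective : ∀ {i j} → at i ≡ at j → i ≡ j
        at-injective {i} {j} e = toℕ-injective (walk-injective simple (toℕ<n i) (toℕ<n j) e)

        Next⇒adj : ∀ {i j} → Next n i j → Adj G (at i) (at j)
        Next⇒adj {i} (inj₁ j≡1+i)         = subst (Adj G (at i) ∘ walk) (sym j≡1+i) (walk-adj (toℕ i))
        Next⇒adj {i} (inj₂ (1+i≡n , j≡0)) = subst (Adj G (at i))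
          (trans (cong walk 1+i≡n) (trans closed (cong walk (sym j≡0)))) (walk-adj (toℕ i))

        -- `walk-neighbours` does not cover position 0, which has no predecessor. Closing up
        -- supplies one: `walk m` is adjacent to `walk (suc m)`, which is `walk 0`.
        start-neighbours : ∀ {z} → Adj G (walk 0) z → z ≡ walk 1 ⊎ z ≡ walk m
        start-neighbours {z} a =
          [ inj₁
          , (λ z≡w → [ (λ m≡1 → contradiction m≡1 walk-m≢walk-1)
                     , (λ m≡w → inj₂ (trans z≡w (sym m≡w))) ]
                     (only (symm G (subst (Adj G (walk m)) closed (walk-adj m)))))
          ] (only a)
          where
          only = proj₂ (proj₂ (proj₂ (other x₀~x₁)))

          walk-m≢walk-1 : walk m ≢ walk 1
          walk-m≢walk-1 = >⇒≢ (s≤s⁻¹ 3≤n) ∘ walk-injective simple ≤-refl (<⇒≤ 3≤n)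

        -- The position `toℕ i` is abstracted to `k` so that the start and the later positions can
        -- be told apart by matching.
        neighbour-visited : ∀ k → k < n → ∀ {i} → toℕ i ≡ k → ∀ {z} → Adj G (walk k) z →
          ∃ λ j → z ≡ at j × Adj C i j
        neighbour-visited zero _ i≡0 a with start-neighbours a
        ... | inj₁ z≡1 = fromℕ< 1<n , trans z≡1 (at-fromℕ< 1<n) ,
                inj₁ (inj₁ (trans (toℕ-fromℕ< 1<n) (cong suc (sym i≡0))))
                where 1<n = <⇒≤ 3≤n
        ... | inj₂ z≡m = fromℕ< ≤-refl , trans z≡m (at-fromℕ< ≤-refl) ,
                inj₂ (inj₂ (cong suc (toℕ-fromℕ< ≤-refl) , i≡0))
        neighbour-visited (suc k) 1+k<n i≡1+k a with walk-neighbours k a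
        ... | inj₁ z≡k = fromℕ< (<⇒≤ 1+k<n) , trans z≡k (at-fromℕ< (<⇒≤ 1+k<n)) ,
                inj₂ (inj₁ (trans i≡1+k (cong suc (sym (toℕ-fromℕ< (<⇒≤ 1+k<n))))))
        ... | inj₂ z≡2+k with m≤n⇒m<n∨m≡n 1+k<n
        ...   | inj₁ 2+k<n = fromℕ< 2+k<n , trans z≡2+k (at-fromℕ< 2+k<n) ,
                  inj₁ (inj₁ (trans (toℕ-fromℕ< 2+k<n) (cong suc (sym i≡1+k))))
        -- Here `suc k` is the last position, and its successor wraps around to 0.
        ...   | inj₂ 2+k≡n = zero , trans z≡2+k (trans (cong walk 2+k≡n) closed) ,
                  inj₁ (inj₂ (trans (cong suc i≡1+k) 2+k≡n , refl))

        at-neighbour : ∀ i {z} → Adj G (at i) z → ∃ λ j → z ≡ at j × Adj C i j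
        at-neighbour i = neighbour-visited (toℕ i) (toℕ<n i) refl

        -- The visited vertices contain all their neighbours, so a path never leaves them.
        at-reachable : ∀ i {z} → Star (Adj G) (at i) z → ∃ λ j → z ≡ at j
        at-reachable i ε = i , refl
        at-reachable i (a ◅ path) with at-neighbour i a
        ... | j , refl , _ = at-reachable j path

      -- Connectedness makes the walk visit every vertex, and simplicity makes the position unique.
      -- Edges correspond because the neighbours of a visited vertex are those at cyclically
      -- adjacent positions.
      walk-≅ : (∀ z → Star (Adj G) x₀ z) → G ≅ C
      walk-≅ path = mk↔ₛ′ index at (λ i → at-injective (sym (at-index (at i)))) (sym ∘ at-index) , adj
        where
        index : V G → Fin n
        index z = proj₁ (at-reachable zero (path z))

        at-index : ∀ z → z ≡ at (index z)
        at-index z = proj₂ (at-reachable zero (path z))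

        adj : ∀ x y → Adj G x y ⇔ Adj C (index x) (index y)
        adj x y = mk⇔ ⇒ ⇐
          where
          ⇒ : Adj G x y → Adj C (index x) (index y)
          ⇒ a with at-neighbour (index x) (subst₂ (Adj G) (at-index x) (at-index y) a)
          ... | j , y≡j , i~j = subst (Adj C (index x)) (sym (at-injective y≡j)) i~j

          ⇐ : Adj C (index x) (index y) → Adj G x y
          ⇐ = subst₂ (Adj G) (sym (at-index x)) (sym (at-index y)) ∘ [ Next⇒adj , symm G ∘ Next⇒adj ]

    firstRepeat⇒cycle : (∀ z → Star (Adj G) x₀ z) →
      ∀ {n} → Repeat n → (∀ {k} → k < n → ¬ Repeat k) → IsCycle G
    firstRepeat⇒cycle path {suc m} (i , i<n , e) simple =
      suc m , closed⇒3≤ z<s closed , walk-≅ simple (closed⇒3≤ z<s closed) closed path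
      where closed = repeat⇒closed simple i i<n e

2-regular⇒cycle : ∀ G → Connected G → (∀ x → degree G x ≡ 2) → IsCycle G
2-regular⇒cycle G (x₀ , path) regular =
  let x₁ , x₀~x₁ = neighbour
      _ , repeat , simple = firstRepeat x₀ x₁ x₀~x₁
  in firstRepeat⇒cycle x₀ x₁ x₀~x₁ (path x₀) repeat simple
  where
  open RegularWalk G regular

  inhabited : ∀ {xs : List (V G)} → length xs ≡ 2 → ∃ (_∈ xs)
  inhabited {x ∷ _} _ = x , here refl

  neighbour : ∃ (Adj G x₀)
  neighbour = let y , y∈ = inhabited (regular x₀) in y , Equivalence.to (∈-neighbours G x₀) y∈

-- Odd closed walks

infix 4 _≈_[mod_]

-- Signed divisibility of the difference lets congruences be added, subtracted and scaled directly;
-- a ring identity then brings the resulting difference into the desired form.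
_≈_[mod_] : ℤ → ℤ → ℕ → Set
i ≈ j [mod n ] = + n ℤ∣.∣ i ℤ.- j

≡⇒≈ : ∀ {n i j} → i ≡ j → i ≈ j [mod n ]
≡⇒≈ {n} {i} refl = divides 0ℤ (ℤ.+-inverseʳ i)

Next⇒≈ : ∀ {n} {i j : Fin n} → Next n i j → + toℕ j ≈ + toℕ i ℤ.+ 1ℤ [mod n ]
Next⇒≈ {n} {i} (inj₁ j≡1+i) = ≡⇒≈ (trans (cong +_ j≡1+i) (ℤ.+-comm 1ℤ (+ toℕ i)))
-- At the wrap-around the difference is 0 - n, so the quotient is -1.
Next⇒≈ {n} {i} {j} (inj₂ (1+i≡n , j≡0)) = divides ℤ.-1ℤ
  (trans (cong (λ t → + t ℤ.- (+ toℕ i ℤ.+ 1ℤ)) j≡0)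
    (trans (identity (+ toℕ i)) (cong (λ t → ℤ.-1ℤ ℤ.* + t) 1+i≡n)))
  where
  identity : ∀ i → 0ℤ ℤ.- (i ℤ.+ 1ℤ) ≡ ℤ.-1ℤ ℤ.* (1ℤ ℤ.+ i)
  identity = solve-∀

-- Unlike `Star`, this type records the length, whose parity and size the argument compares.
data Walk (G : Graph) : ℕ → V G → V G → Set where
  []  : ∀ {x} → Walk G 0 x x
  _∷_ : ∀ {k x y z} → Adj G x y → Walk G k y z → Walk G (suc k) x z

mapWalk : ∀ G H (f : V G → V H) → (∀ {x y} → Adj G x y → Adj H (f x) (f y)) →
  ∀ {k x y} → Walk G k x y → Walk H k (f x) (f y)
mapWalk G H f f-adj []      = []
mapWalk G H f f-adj (a ∷ w) = f-adj a ∷ mapWalk G H f f-adj w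

Star⇒Walk : ∀ G {x y} → Star (Adj G) x y → ∃ λ k → Walk G k x y
Star⇒Walk G ε = 0 , []
Star⇒Walk G (a ◅ p) = let k , w = Star⇒Walk G p in suc k , a ∷ w

-- a and b count the forward and the backward steps.
displacement : ∀ {n} (3≤n : 3 ≤ n) {k i j} → Walk (cycle n 3≤n) k i j →
  ∃₂ λ a b → a + b ≡ k × + toℕ j ℤ.- + toℕ i ≈ + a ℤ.- + b [mod n ]
displacement 3≤n {i = i} [] = 0 , 0 , refl , ≡⇒≈ (ℤ.+-inverseʳ (+ toℕ i))
displacement {n} 3≤n {i = i} {j} (_∷_ {y = l} (inj₁ i→l) w) =
  let a , b , a+b≡k , w≈ = displacement 3≤n w in
  suc a , b , cong suc a+b≡k ,
  subst (+ n ℤ∣.∣_) (identity (+ toℕ i) (+ toℕ l) (+ toℕ j) (+ a) (+ b))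
    (ℤ∣.∣m∣n⇒∣m+n (Next⇒≈ i→l) w≈)
  where
  identity : ∀ i l j a b →
    (l ℤ.- (i ℤ.+ 1ℤ)) ℤ.+ (j ℤ.- l ℤ.- (a ℤ.- b)) ≡ j ℤ.- i ℤ.- ((1ℤ ℤ.+ a) ℤ.- b)
  identity = solve-∀
displacement {n} 3≤n {i = i} {j} (_∷_ {y = l} (inj₂ l→i) w) =
  let a , b , a+b≡k , w≈ = displacement 3≤n w in
  a , suc b , trans (+-suc a b) (cong suc a+b≡k) ,
  subst (+ n ℤ∣.∣_) (identity (+ toℕ i) (+ toℕ l) (+ toℕ j) (+ a) (+ b))
    (ℤ∣.∣m∣n⇒∣m-n w≈ (Next⇒≈ l→i))
  where
  identity : ∀ i l j a b →
    (j ℤ.- l ℤ.- (a ℤ.- b)) ℤ.- (i ℤ.- (l ℤ.+ 1ℤ)) ≡ j ℤ.- i ℤ.- (a ℤ.- (1ℤ ℤ.+ b))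
  identity = solve-∀

oddClosedWalk : ∀ {n} (3≤n : 3 ≤ n) {k i} → ¬ 2 ∣ k → Walk (cycle n 3≤n) k i i → ¬ 2 ∣ n × n ≤ k
oddClosedWalk {n} 3≤n {k} {i} k-odd w = n-odd , ≤-trans (∣⇒≤ n∣∣a-b∣) ∣a-b∣≤k
  where
  a = proj₁ (displacement 3≤n w)
  b = proj₁ (proj₂ (displacement 3≤n w))

  a+b≡k : a + b ≡ k
  a+b≡k = proj₁ (proj₂ (proj₂ (displacement 3≤n w)))

  n∣a-b : + n ℤ∣.∣ + a ℤ.- + b
  n∣a-b = subst (+ n ℤ∣.∣_) (identity (+ toℕ i) (+ a) (+ b))
    (ℤ∣.∣m⇒∣-m (proj₂ (proj₂ (proj₂ (displacement 3≤n w)))))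
    where
    identity : ∀ i a b → ℤ.- (i ℤ.- i ℤ.- (a ℤ.- b)) ≡ a ℤ.- b
    identity = solve-∀

  n∣∣a-b∣ : n ∣ abs (+ a ℤ.- + b)
  n∣∣a-b∣ = ℤ∣.∣⇒∣ᵤ n∣a-b

  2∣a-b⇒⊥ : ¬ + 2 ℤ∣.∣ + a ℤ.- + b
  -- Adding 2b to a - b gives a + b, so the two have the same parity.
  2∣a-b⇒⊥ 2∣a-b = k-odd (subst (2 ∣_) a+b≡k (ℤ∣.∣⇒∣ᵤ (subst (+ 2 ℤ∣.∣_) (identity (+ a) (+ b))
    (ℤ∣.∣m∣n⇒∣m+n 2∣a-b (divides (+ b) refl)))))
    where
    identity : ∀ a b → (a ℤ.- b) ℤ.+ b ℤ.* + 2 ≡ a ℤ.+ b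
    identity = solve-∀

  n-odd : ¬ 2 ∣ n
  n-odd 2∣n = 2∣a-b⇒⊥ (ℤ∣.∣-trans (ℤ∣.∣ᵤ⇒∣ 2∣n) n∣a-b)

  -- Zero would be even. Being nonzero is what turns divisibility by n into the bound n ≤ |a - b|.
  instance
    ∣a-b∣-nonZero : NonZero (abs (+ a ℤ.- + b))
    ∣a-b∣-nonZero = ≢-nonZero λ ≡0 → 2∣a-b⇒⊥ (divides 0ℤ (ℤ.∣i∣≡0⇒i≡0 ≡0))

  ∣a-b∣≤k : abs (+ a ℤ.- + b) ≤ k
  ∣a-b∣≤k = ≤-trans (ℤ.∣i-j∣≤∣i∣+∣j∣ (+ a) (+ b)) (≤-reflexive a+b≡k)

fullTurn : ∀ {n} (3≤n : 3 ≤ n) → ∃ λ i → Walk (cycle n 3≤n) n i i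
fullTurn {suc m} 3≤n = zero , ascend m refl
  where
  -- `k` counts the steps still to go up to vertex `m`; the extra step in `suc k` wraps around to 0.
  ascend : ∀ k {i} → toℕ i + k ≡ m → Walk (cycle (suc m) 3≤n) (suc k) i zero
  ascend zero {i} i+0≡m = inj₁ (inj₂ (cong suc (trans (sym (+-identityʳ (toℕ i))) i+0≡m) , refl)) ∷ []
  ascend (suc k) {i} i+1+k≡m =
    inj₁ (inj₁ (toℕ-fromℕ< 1+i<n)) ∷ ascend k (trans (cong (_+ k) (toℕ-fromℕ< 1+i<n)) 1+i+k≡m)
    where
    1+i+k≡m = trans (sym (+-suc (toℕ i) k)) i+1+k≡m
    1+i<n = s≤s (≤-trans (m≤m+n (suc (toℕ i)) k) (≤-reflexive 1+i+k≡m))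

consecutive-odd : ∀ {k} → 2 ∣ k → ¬ 2 ∣ suc k
consecutive-odd {k} 2∣k 2∣1+k with () ← ∣1⇒≡1 (∣m+n∣m⇒∣n (subst (2 ∣_) (+-comm 1 k) 2∣1+k) 2∣k)

□-path : ∀ G H {x x′ y y′} → Star (Adj G) x x′ → Star (Adj H) y y′ →
  Star (Adj (G □ H)) (x , y) (x′ , y′)
□-path G H {x′ = x′} {y = y} p q =
  gmap (_, y) (λ a → inj₁ (a , refl)) p ◅◅ gmap (x′ ,_) (λ a → inj₂ (refl , a)) q

-- Comparing the lengths of the two cycles

module _ (G H : Graph) (G-conn : Connected G) (H-conn : Connected H) (φ : (G □ H) ≅ (G ⊗ H))
         {m n} (3≤m : 3 ≤ m) (3≤n : 3 ≤ n) (G≅C : G ≅ cycle m 3≤m) (H≅C : H ≅ cycle n 3≤n) where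

  private
    □-walk⇒⊗-walk : ∀ {k p q} → Walk (G □ H) k p q →
      Walk (G ⊗ H) k (to (proj₁ φ) p) (to (proj₁ φ) q)
    □-walk⇒⊗-walk = mapWalk (G □ H) (G ⊗ H) _ (Equivalence.to (proj₂ φ _ _))

    ⊗-walkˡ : ∀ {k p q} → Walk (G ⊗ H) k p q → Walk G k (proj₁ p) (proj₁ q)
    ⊗-walkˡ = mapWalk (G ⊗ H) G proj₁ proj₁

    ⊗-walkʳ : ∀ {k p q} → Walk (G ⊗ H) k p q → Walk H k (proj₂ p) (proj₂ q)
    ⊗-walkʳ = mapWalk (G ⊗ H) H proj₂ proj₂

  G-oddClosedWalk : ∀ {k x} → ¬ 2 ∣ k → Walk G k x x → ¬ 2 ∣ m × m ≤ k
  G-oddClosedWalk k-odd = oddClosedWalk 3≤m k-odd ∘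
    mapWalk G (cycle m 3≤m) _ (Equivalence.to (proj₂ G≅C _ _))

  H-oddClosedWalk : ∀ {k y} → ¬ 2 ∣ k → Walk H k y y → ¬ 2 ∣ n × n ≤ k
  H-oddClosedWalk k-odd = oddClosedWalk 3≤n k-odd ∘
    mapWalk H (cycle n 3≤n) _ (Equivalence.to (proj₂ H≅C _ _))

  G-fullTurn : ∃ λ x → Walk G m x x
  G-fullTurn = _ , mapWalk (cycle m 3≤m) G _
    (Equivalence.to (proj₂ (≅-sym G (cycle m 3≤m) G≅C) _ _)) (proj₂ (fullTurn 3≤m))

  H-fullTurn : ∃ λ y → Walk H n y y
  H-fullTurn = _ , mapWalk (cycle n 3≤n) H _
    (Equivalence.to (proj₂ (≅-sym H (cycle n 3≤n) H≅C) _ _)) (proj₂ (fullTurn 3≤n))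

  -- The full turn runs in the layer of `G □ H` over one vertex of `H`. The projections of `G ⊗ H`
  -- send every edge to an edge, so the transported turn projects to a closed walk in `H` of the
  -- same length.
  m-odd⇒n≤m : ¬ 2 ∣ m → ¬ 2 ∣ n × n ≤ m
  m-odd⇒n≤m m-odd = H-oddClosedWalk m-odd (⊗-walkʳ (□-walk⇒⊗-walk
    (mapWalk G (G □ H) (_, proj₁ H-conn) (λ a → inj₁ (a , refl)) (proj₂ G-fullTurn))))

  n-odd⇒m≤n : ¬ 2 ∣ n → ¬ 2 ∣ m × m ≤ n
  n-odd⇒m≤n n-odd = G-oddClosedWalk n-odd (⊗-walkˡ (□-walk⇒⊗-walk
    (mapWalk H (G □ H) (proj₁ G-conn ,_) (λ a → inj₂ (refl , a)) (proj₂ H-fullTurn))))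

  -- Connectedness comes from `G □ H` through the isomorphism; in general a Kronecker product of
  -- connected graphs may be disconnected.
  ⊗-connected : ∀ p q → ∃ λ k → Walk (G ⊗ H) k p q
  ⊗-connected p q =
    let k , w = Star⇒Walk (G □ H) (□-path G H (proj₂ G-conn _ _) (proj₂ H-conn _ _)) in
    k , subst₂ (Walk (G ⊗ H) k) (strictlyInverseˡ (proj₁ φ) p) (strictlyInverseˡ (proj₁ φ) q)
          (□-walk⇒⊗-walk w)

  -- A walk in G ⊗ H from (x′ , y) to (x , y) with x ~ x′ projects to a closed walk in H
  -- and, prefixed by x ~ x′, to a closed walk in G: one of the two has odd length.
  oneOdd : ¬ 2 ∣ m ⊎ ¬ 2 ∣ n
  oneOdd with G-edge 3≤m G-fullTurn
    where
    G-edge : ∀ {k} → 3 ≤ k → (∃ λ x → Walk G k x x) → ∃₂ (Adj G)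
    G-edge (s≤s _) (x , a ∷ _) = x , _ , a
  ... | x , x′ , x~x′ with ⊗-connected (x′ , proj₁ H-conn) (x , proj₁ H-conn)
  ...   | k , w with 2 ∣? k
  ...     | yes 2∣k = inj₁ (proj₁ (G-oddClosedWalk (consecutive-odd 2∣k) (x~x′ ∷ ⊗-walkˡ w)))
  ...     | no 2∤k  = inj₂ (proj₁ (H-oddClosedWalk 2∤k (⊗-walkʳ w)))

  equalOddLengths : ¬ 2 ∣ m × m ≡ n
  equalOddLengths =
    let m-odd = [ id , proj₁ ∘ n-odd⇒m≤n ] oneOdd
        n-odd , n≤m = m-odd⇒n≤m m-odd
    in m-odd , ≤-antisym (proj₂ (n-odd⇒m≤n n-odd)) n≤m

-- The product of an odd cycle with itself

2∣⊎2∣suc : ∀ n → 2 ∣ n ⊎ 2 ∣ suc n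
2∣⊎2∣suc zero = inj₁ (divides 0 refl)
2∣⊎2∣suc (suc n) with 2∣⊎2∣suc n
... | inj₁ 2∣n   = inj₂ (∣m∣n⇒∣m+n (∣-refl {2}) 2∣n)
... | inj₂ 2∣1+n = inj₁ 2∣1+n

-- Two numbers below n differ by less than n, and the only such multiple of n is 0.
toℕ-≈-injective : ∀ {n} {i j : Fin n} → + toℕ i ≈ + toℕ j [mod n ] → i ≡ j
toℕ-≈-injective {n} {i} {j} i≈j with abs (+ toℕ i ℤ.- + toℕ j) in eq | ℤ∣.∣⇒∣ᵤ i≈j | bound
  where
  bound : abs (+ toℕ i ℤ.- + toℕ j) < n
  bound = subst (_< n) (cong abs (sym (ℤ.m-n≡m⊖n (toℕ i) (toℕ j))))
    (≤-<-trans (ℤ.∣m⊝n∣≤m⊔n (toℕ i) (toℕ j)) (⊔-lub (toℕ<n i) (toℕ<n j)))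
... | zero  | _   | _   = toℕ-injective (ℤ.+-injective (ℤ.i-j≡0⇒i≡j _ _ (ℤ.∣i∣≡0⇒i≡0 eq)))
... | suc _ | n∣d | d<n = contradiction n∣d (>⇒∤ d<n)

-- The congruence determines `j`, so it suffices to compare it with the residue of i + 1: that
-- number itself, or 0 if it equals n.
≈⇒Next : ∀ {n} {i j : Fin n} → + toℕ j ≈ + toℕ i ℤ.+ 1ℤ [mod n ] → Next n i j
≈⇒Next {n@(suc _)} {i} {j} j≈1+i with m≤n⇒m<n∨m≡n (toℕ<n i)
... | inj₁ 1+i<n = inj₁ (trans (cong toℕ (toℕ-≈-injective {i = j} {fromℕ< 1+i<n}
        (subst (λ t → + toℕ j ≈ t [mod n ])
          (trans (ℤ.+-comm (+ toℕ i) 1ℤ) (cong +_ (sym (toℕ-fromℕ< 1+i<n)))) j≈1+i)))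
        (toℕ-fromℕ< 1+i<n))
... | inj₂ 1+i≡n = inj₂ (1+i≡n , cong toℕ (toℕ-≈-injective {i = j} {zero}
        (subst (+ n ℤ∣.∣_) (identity (+ toℕ i) (+ toℕ j)) (ℤ∣.∣m∣n⇒∣m+n j≈1+i
          (divides 1ℤ (trans (cong +_ 1+i≡n) (sym (ℤ.*-identityˡ (+ n)))))))))
  where
  identity : ∀ i j → (j ℤ.- (i ℤ.+ 1ℤ)) ℤ.+ (1ℤ ℤ.+ i) ≡ j ℤ.- 0ℤ
  identity = solve-∀

-- h is an inverse of 2 modulo n.
module OddCycle (n : ℕ) (3≤n : 3 ≤ n) .{{_ : NonZero n}} (h : ℕ) (2h≡1+n : h * 2 ≡ suc n) where

  private
    C = cycle n 3≤n
    N = + n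

    -- Since 2h - 1 = n, the difference is (2h - 1)z = zn.
    half : ∀ z → + h ℤ.* (+ 2 ℤ.* z) ≈ z [mod n ]
    half z = divides z (trans (identity₁ (+ h) z)
      (trans (cong (λ t → (t ℤ.- 1ℤ) ℤ.* z) 2h≡1+n′) (identity₂ N z)))
      where
      2h≡1+n′ : + h ℤ.* + 2 ≡ 1ℤ ℤ.+ N
      2h≡1+n′ = trans (sym (ℤ.pos-* h 2)) (cong +_ 2h≡1+n)
      identity₁ : ∀ h z → h ℤ.* (+ 2 ℤ.* z) ℤ.- z ≡ (h ℤ.* + 2 ℤ.- 1ℤ) ℤ.* z
      identity₁ = solve-∀
      identity₂ : ∀ n z → (1ℤ ℤ.+ n ℤ.- 1ℤ) ℤ.* z ≡ z ℤ.* n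
      identity₂ = solve-∀

    -- Multiplication by `h` undoes the factor 2.
    cancel-2 : ∀ {z} → N ℤ∣.∣ + 2 ℤ.* z → N ℤ∣.∣ z
    cancel-2 {z} d = subst (N ℤ∣.∣_) (identity (+ h ℤ.* (+ 2 ℤ.* z)) z)
      (ℤ∣.∣m∣n⇒∣m-n (ℤ∣.∣n⇒∣m*n (+ h) d) (half z))
      where
      identity : ∀ w z → w ℤ.- (w ℤ.- z) ≡ z
      identity = solve-∀

    -- The remainder `%ℕ` is nonnegative for negative integers too, as differences require.
    ⟦_⟧ : ℤ → Fin n
    ⟦ z ⟧ = fromℕ< (n%ℕd<d z n)

    toℕ-⟦⟧ : ∀ z → z ≈ + toℕ ⟦ z ⟧ [mod n ]
    toℕ-⟦⟧ z = divides (z /ℕ n) (trans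
      (cong₂ ℤ._-_ (a≡a%ℕn+[a/ℕn]*n z n) (cong +_ (toℕ-fromℕ< (n%ℕd<d z n))))
      (identity (+ (z %ℕ n)) ((z /ℕ n) ℤ.* N)))
      where
      identity : ∀ r t → (r ℤ.+ t) ℤ.- r ≡ t
      identity = solve-∀

    ⟦⟧-≡ : ∀ z {i} → z ≈ + toℕ i [mod n ] → ⟦ z ⟧ ≡ i
    ⟦⟧-≡ z {i} z≈i = toℕ-≈-injective
      (subst (N ℤ∣.∣_) (identity z (+ toℕ ⟦ z ⟧) (+ toℕ i)) (ℤ∣.∣m∣n⇒∣m-n z≈i (toℕ-⟦⟧ z)))
      where
      identity : ∀ z t i → (z ℤ.- i) ℤ.- (z ℤ.- t) ≡ t ℤ.- i
      identity = solve-∀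

    -- Together with `next-⟦⟧⁻¹` this allows adjacency to be checked on integers before reduction
    -- modulo n.
    next-⟦⟧ : ∀ z w → w ≈ z ℤ.+ 1ℤ [mod n ] → Next n ⟦ z ⟧ ⟦ w ⟧
    next-⟦⟧ z w w≈1+z = ≈⇒Next (subst (N ℤ∣.∣_) (identity z w (+ toℕ ⟦ z ⟧) (+ toℕ ⟦ w ⟧))
      (ℤ∣.∣m∣n⇒∣m-n (ℤ∣.∣m∣n⇒∣m+n w≈1+z (toℕ-⟦⟧ z)) (toℕ-⟦⟧ w)))
      where
      identity : ∀ z w s t → (w ℤ.- (z ℤ.+ 1ℤ)) ℤ.+ (z ℤ.- s) ℤ.- (w ℤ.- t) ≡ t ℤ.- (s ℤ.+ 1ℤ)
      identity = solve-∀

    next-⟦⟧⁻¹ : ∀ z w → Next n ⟦ z ⟧ ⟦ w ⟧ → w ≈ z ℤ.+ 1ℤ [mod n ]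
    next-⟦⟧⁻¹ z w next = subst (N ℤ∣.∣_) (identity z w (+ toℕ ⟦ z ⟧) (+ toℕ ⟦ w ⟧))
      (ℤ∣.∣m∣n⇒∣m-n (ℤ∣.∣m∣n⇒∣m+n (Next⇒≈ next) (toℕ-⟦⟧ w)) (toℕ-⟦⟧ z))
      where
      identity : ∀ z w s t → (t ℤ.- (s ℤ.+ 1ℤ)) ℤ.+ (w ℤ.- t) ℤ.- (z ℤ.- s) ≡ w ℤ.- (z ℤ.+ 1ℤ)
      identity = solve-∀

    add sub : Fin n → Fin n → ℤ
    add x y = + toℕ x ℤ.+ + toℕ y
    sub x y = + toℕ x ℤ.- + toℕ y

    -- The second summand is an arbitrary integer, so that taking y or -y serves both sums and
    -- differences.
    horizontal : ∀ {x x′ : Fin n} y → Next n x x′ → + toℕ x′ ℤ.+ y ≈ (+ toℕ x ℤ.+ y) ℤ.+ 1ℤ [mod n ]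
    horizontal {x} {x′} y next = subst (N ℤ∣.∣_) (identity (+ toℕ x) (+ toℕ x′) y) (Next⇒≈ next)
      where
      identity : ∀ x x′ y → x′ ℤ.- (x ℤ.+ 1ℤ) ≡ (x′ ℤ.+ y) ℤ.- ((x ℤ.+ y) ℤ.+ 1ℤ)
      identity = solve-∀

    vertical⁺ : ∀ x {y y′ : Fin n} → Next n y y′ → x ℤ.+ + toℕ y′ ≈ (x ℤ.+ + toℕ y) ℤ.+ 1ℤ [mod n ]
    vertical⁺ x {y} {y′} next = subst (N ℤ∣.∣_) (identity x (+ toℕ y) (+ toℕ y′)) (Next⇒≈ next)
      where
      identity : ∀ x y y′ → y′ ℤ.- (y ℤ.+ 1ℤ) ≡ (x ℤ.+ y′) ℤ.- ((x ℤ.+ y) ℤ.+ 1ℤ)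
      identity = solve-∀

    -- A step forward in y lowers x - y, hence the exchanged roles of `y` and `y′`.
    vertical⁻ : ∀ x {y y′ : Fin n} → Next n y y′ → x ℤ.- + toℕ y ≈ (x ℤ.- + toℕ y′) ℤ.+ 1ℤ [mod n ]
    vertical⁻ x {y} {y′} next = subst (N ℤ∣.∣_) (identity x (+ toℕ y) (+ toℕ y′)) (Next⇒≈ next)
      where
      identity : ∀ x y y′ → y′ ℤ.- (y ℤ.+ 1ℤ) ≡ (x ℤ.- y) ℤ.- ((x ℤ.- y′) ℤ.+ 1ℤ)
      identity = solve-∀

    -- If u = x + y and v = x − y both increase by one then 2x increases by two and 2y is unchanged.
    diagonal : ∀ {x x′ y y′ : Fin n} →
      add x′ y′ ≈ add x y ℤ.+ 1ℤ [mod n ] →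
      sub x′ y′ ≈ sub x y ℤ.+ 1ℤ [mod n ] →
      Next n x x′ × y ≡ y′
    diagonal {x} {x′} {y} {y′} u→u′ v→v′ =
      ≈⇒Next (cancel-2
        (subst (N ℤ∣.∣_) (identity₁ (+ toℕ x) (+ toℕ x′) (+ toℕ y) (+ toℕ y′)) (ℤ∣.∣m∣n⇒∣m+n u→u′ v→v′))) ,
      toℕ-≈-injective (cancel-2
        (subst (N ℤ∣.∣_) (identity₂ (+ toℕ x) (+ toℕ x′) (+ toℕ y) (+ toℕ y′)) (ℤ∣.∣m∣n⇒∣m-n v→v′ u→u′)))
      where
      identity₁ : ∀ x x′ y y′ →
        (x′ ℤ.+ y′ ℤ.- (x ℤ.+ y ℤ.+ 1ℤ)) ℤ.+ (x′ ℤ.- y′ ℤ.- (x ℤ.- y ℤ.+ 1ℤ)) ≡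
        + 2 ℤ.* (x′ ℤ.- (x ℤ.+ 1ℤ))
      identity₁ = solve-∀
      identity₂ : ∀ x x′ y y′ →
        (x′ ℤ.- y′ ℤ.- (x ℤ.- y ℤ.+ 1ℤ)) ℤ.- (x′ ℤ.+ y′ ℤ.- (x ℤ.+ y ℤ.+ 1ℤ)) ≡
        + 2 ℤ.* (y ℤ.- y′)
      identity₂ = solve-∀

    -- Here u increases and v decreases by one, so 2x is unchanged and 2y grows by two; the factor 2
    -- cancels.
    antidiagonal : ∀ {x x′ y y′ : Fin n} →
      add x′ y′ ≈ add x y ℤ.+ 1ℤ [mod n ] →
      sub x y ≈ sub x′ y′ ℤ.+ 1ℤ [mod n ] →
      x ≡ x′ × Next n y y′
    antidiagonal {x} {x′} {y} {y′} u→u′ v′→v =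
      toℕ-≈-injective (cancel-2
        (subst (N ℤ∣.∣_) (identity₁ (+ toℕ x) (+ toℕ x′) (+ toℕ y) (+ toℕ y′)) (ℤ∣.∣m∣n⇒∣m-n v′→v u→u′))) ,
      ≈⇒Next (cancel-2
        (subst (N ℤ∣.∣_) (identity₂ (+ toℕ x) (+ toℕ x′) (+ toℕ y) (+ toℕ y′)) (ℤ∣.∣m∣n⇒∣m+n u→u′ v′→v)))
      where
      identity₁ : ∀ x x′ y y′ →
        (x ℤ.- y ℤ.- (x′ ℤ.- y′ ℤ.+ 1ℤ)) ℤ.- (x′ ℤ.+ y′ ℤ.- (x ℤ.+ y ℤ.+ 1ℤ)) ≡
        + 2 ℤ.* (x ℤ.- x′)
      identity₁ = solve-∀
      identity₂ : ∀ x x′ y y′ →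
        (x′ ℤ.+ y′ ℤ.- (x ℤ.+ y ℤ.+ 1ℤ)) ℤ.+ (x ℤ.- y ℤ.- (x′ ℤ.- y′ ℤ.+ 1ℤ)) ≡
        + 2 ℤ.* (y′ ℤ.- (y ℤ.+ 1ℤ))
      identity₂ = solve-∀

    rotate : Fin n × Fin n → Fin n × Fin n
    rotate (x , y) = ⟦ add x y ⟧ , ⟦ sub x y ⟧

    -- Solving u = x + y, v = x - y gives x = (u + v)/2 and y = (u - v)/2, with `h` as one half.
    unrotate : Fin n × Fin n → Fin n × Fin n
    unrotate (u , v) = ⟦ + h ℤ.* add u v ⟧ , ⟦ + h ℤ.* sub u v ⟧

    -- The sum and difference of h(u + v) and h(u - v) are 2hu and 2hv, to which `half` applies;
    -- `X≈` and `Y≈` account for the reduction to residues.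
    rotate-unrotate : ∀ p → rotate (unrotate p) ≡ p
    rotate-unrotate (u , v) = cong₂ _,_
      (⟦⟧-≡ (X ℤ.+ Y)
        (subst (N ℤ∣.∣_) (identity₁ (+ h) U W X Y)
          (ℤ∣.∣m∣n⇒∣m-n (half U) (ℤ∣.∣m∣n⇒∣m+n X≈ Y≈))))
      (⟦⟧-≡ (X ℤ.- Y)
        (subst (N ℤ∣.∣_) (identity₂ (+ h) U W X Y)
          (ℤ∣.∣m∣n⇒∣m-n (half W) (ℤ∣.∣m∣n⇒∣m-n X≈ Y≈))))
      where
      U = + toℕ u
      W = + toℕ v
      X = + toℕ ⟦ + h ℤ.* (U ℤ.+ W) ⟧
      Y = + toℕ ⟦ + h ℤ.* (U ℤ.- W) ⟧
      X≈ = toℕ-⟦⟧ (+ h ℤ.* (U ℤ.+ W))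
      Y≈ = toℕ-⟦⟧ (+ h ℤ.* (U ℤ.- W))
      identity₁ : ∀ h u v x y →
        (h ℤ.* (+ 2 ℤ.* u) ℤ.- u) ℤ.- ((h ℤ.* (u ℤ.+ v) ℤ.- x) ℤ.+ (h ℤ.* (u ℤ.- v) ℤ.- y)) ≡
        (x ℤ.+ y) ℤ.- u
      identity₁ = solve-∀
      identity₂ : ∀ h u v x y →
        (h ℤ.* (+ 2 ℤ.* v) ℤ.- v) ℤ.- ((h ℤ.* (u ℤ.+ v) ℤ.- x) ℤ.- (h ℤ.* (u ℤ.- v) ℤ.- y)) ≡
        (x ℤ.- y) ℤ.- v
      identity₂ = solve-∀

    -- The sum and difference of x + y and x - y are 2x and 2y, and `half` removes the factor 2h.
    unrotate-rotate : ∀ p → unrotate (rotate p) ≡ p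
    unrotate-rotate (x , y) = cong₂ _,_
      (⟦⟧-≡ (+ h ℤ.* (U ℤ.+ W))
        (subst (N ℤ∣.∣_) (identity₁ (+ h) U W X Y)
          (ℤ∣.∣m∣n⇒∣m-n (half X) (ℤ∣.∣n⇒∣m*n (+ h) (ℤ∣.∣m∣n⇒∣m+n U≈ W≈)))))
      (⟦⟧-≡ (+ h ℤ.* (U ℤ.- W))
        (subst (N ℤ∣.∣_) (identity₂ (+ h) U W X Y)
          (ℤ∣.∣m∣n⇒∣m-n (half Y) (ℤ∣.∣n⇒∣m*n (+ h) (ℤ∣.∣m∣n⇒∣m-n U≈ W≈)))))
      where
      X = + toℕ x
      Y = + toℕ y
      U = + toℕ ⟦ X ℤ.+ Y ⟧
      W = + toℕ ⟦ X ℤ.- Y ⟧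
      U≈ = toℕ-⟦⟧ (X ℤ.+ Y)
      W≈ = toℕ-⟦⟧ (X ℤ.- Y)
      identity₁ : ∀ h u v x y →
        (h ℤ.* (+ 2 ℤ.* x) ℤ.- x) ℤ.- h ℤ.* ((x ℤ.+ y ℤ.- u) ℤ.+ (x ℤ.- y ℤ.- v)) ≡
        h ℤ.* (u ℤ.+ v) ℤ.- x
      identity₁ = solve-∀
      identity₂ : ∀ h u v x y →
        (h ℤ.* (+ 2 ℤ.* y) ℤ.- y) ℤ.- h ℤ.* ((x ℤ.+ y ℤ.- u) ℤ.- (x ℤ.- y ℤ.- v)) ≡
        h ℤ.* (u ℤ.- v) ℤ.- y
      identity₂ = solve-∀

    -- A horizontal step moves sum and difference in the same direction, a vertical step in opposite
    -- directions.
    □⇒⊗ : ∀ {p q} → Adj (C □ C) p q → Adj (C ⊗ C) (rotate p) (rotate q)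
    □⇒⊗ {x , y} {x′ , _} (inj₁ (inj₁ x→x′ , refl)) =
      inj₁ (next-⟦⟧ (add x y) (add x′ y) (horizontal (+ toℕ y) x→x′)) ,
      inj₁ (next-⟦⟧ (sub x y) (sub x′ y) (horizontal (ℤ.- + toℕ y) x→x′))
    □⇒⊗ {x , y} {x′ , _} (inj₁ (inj₂ x′→x , refl)) =
      inj₂ (next-⟦⟧ (add x′ y) (add x y) (horizontal (+ toℕ y) x′→x)) ,
      inj₂ (next-⟦⟧ (sub x′ y) (sub x y) (horizontal (ℤ.- + toℕ y) x′→x))
    □⇒⊗ {x , y} {_ , y′} (inj₂ (refl , inj₁ y→y′)) =
      inj₁ (next-⟦⟧ (add x y) (add x y′) (vertical⁺ (+ toℕ x) y→y′)) ,
      inj₂ (next-⟦⟧ (sub x y′) (sub x y) (vertical⁻ (+ toℕ x) y→y′))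
    □⇒⊗ {x , y} {_ , y′} (inj₂ (refl , inj₂ y′→y)) =
      inj₂ (next-⟦⟧ (add x y′) (add x y) (vertical⁺ (+ toℕ x) y′→y)) ,
      inj₁ (next-⟦⟧ (sub x y) (sub x y′) (vertical⁻ (+ toℕ x) y′→y))

    ⊗⇒□ : ∀ {p q} → Adj (C ⊗ C) (rotate p) (rotate q) → Adj (C □ C) p q
    ⊗⇒□ {x , y} {x′ , y′} (inj₁ u→u′ , inj₁ v→v′) =
      let x→x′ , y≡y′ = diagonal
            (next-⟦⟧⁻¹ (add x y) (add x′ y′) u→u′)
            (next-⟦⟧⁻¹ (sub x y) (sub x′ y′) v→v′)
      in inj₁ (inj₁ x→x′ , y≡y′)
    -- This is the previous case read from q to p.
    ⊗⇒□ {x , y} {x′ , y′} (inj₂ u′→u , inj₂ v′→v) =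
      let x′→x , y′≡y = diagonal
            (next-⟦⟧⁻¹ (add x′ y′) (add x y) u′→u)
            (next-⟦⟧⁻¹ (sub x′ y′) (sub x y) v′→v)
      in inj₁ (inj₂ x′→x , sym y′≡y)
    ⊗⇒□ {x , y} {x′ , y′} (inj₁ u→u′ , inj₂ v′→v) =
      let x≡x′ , y→y′ = antidiagonal
            (next-⟦⟧⁻¹ (add x y) (add x′ y′) u→u′)
            (next-⟦⟧⁻¹ (sub x′ y′) (sub x y) v′→v)
      in inj₂ (x≡x′ , inj₁ y→y′)
    ⊗⇒□ {x , y} {x′ , y′} (inj₂ u′→u , inj₁ v→v′) =
      let x′≡x , y′→y = antidiagonal
            (next-⟦⟧⁻¹ (add x′ y′) (add x y) u′→u)
            (next-⟦⟧⁻¹ (sub x y) (sub x′ y′) v→v′)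
      in inj₂ (sym x′≡x , inj₂ y′→y)

  □≅⊗ : (C □ C) ≅ (C ⊗ C)
  □≅⊗ = mk↔ₛ′ rotate unrotate rotate-unrotate unrotate-rotate , λ p q → mk⇔ □⇒⊗ ⊗⇒□

cycle-□≅⊗ : ∀ {n} (3≤n : 3 ≤ n) → ¬ 2 ∣ n → (cycle n 3≤n □ cycle n 3≤n) ≅ (cycle n 3≤n ⊗ cycle n 3≤n)
cycle-□≅⊗ {n@(suc _)} 3≤n n-odd with 2∣⊎2∣suc n
... | inj₁ 2∣n           = contradiction 2∣n n-odd
-- From n + 1 = 2h, the quotient `h` is an inverse of 2 modulo n.
... | inj₂ (divides h e) = OddCycle.□≅⊗ n 3≤n h (sym e)

theorem3p1 : (G H : Graph) → Connected G → Connected H → NotBothTrivial G H →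
    ((G □ H) ≅ (G ⊗ H)) ⇔ (∃ λ n → IsOddCycleOfLength n G × IsOddCycleOfLength n H)
theorem3p1 G H G-conn H-conn ¬triv = mk⇔ ⇒ ⇐
  where
  ⇒ : (G □ H) ≅ (G ⊗ H) → ∃ λ n → IsOddCycleOfLength n G × IsOddCycleOfLength n H
  ⇒ φ =
    let G-regular , H-regular = 2-regular G H φ G-conn H-conn ¬triv
        m , 3≤m , G≅C = 2-regular⇒cycle G G-conn G-regular
        n , 3≤n , H≅C = 2-regular⇒cycle H H-conn H-regular
        m-odd , m≡n = equalOddLengths G H G-conn H-conn φ 3≤m 3≤n G≅C H≅C
    in m , (m-odd , 3≤m , G≅C) ,
       subst (λ k → IsOddCycleOfLength k H) (sym m≡n) (subst (λ k → ¬ 2 ∣ k) m≡n m-odd , 3≤n , H≅C)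

  ⇐ : (∃ λ n → IsOddCycleOfLength n G × IsOddCycleOfLength n H) → (G □ H) ≅ (G ⊗ H)
  -- Identifying the two proofs of 3 ≤ n makes both cycles literally the same graph.
  ⇐ (n , (n-odd , 3≤n , G≅C) , (_ , 3≤n′ , H≅C)) with refl ← ≤-irrelevant 3≤n 3≤n′ =
    ≅-trans (G □ H) (C □ C) (G ⊗ H) (□-cong G C H C G≅C H≅C)
      (≅-trans (C □ C) (C ⊗ C) (G ⊗ H) (cycle-□≅⊗ 3≤n n-odd)
        (≅-sym (G ⊗ H) (C ⊗ C) (⊗-cong G C H C G≅C H≅C)))
    where C = cycle n 3≤n
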